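{- Let $q$ be a prime power and $A\subseteq\mathbb{F}_q$. Then \[|[A,A,0][A,A,0]|\gg\min\left\{\frac{|A|^5}{q},\ \frac{q|A|^5}{E^+(A)}\right\},\] where $E^+(A)$ is the number of quadruples $(a,b,c,d)\in A^4$ with $a+b=c+d$.
   Context: The Heisenberg group $H_1(\mathbb{F}_q)$ consists of the matrices $[x,y,z]=\begin{bmatrix}1&x&z\\0&1&y\\0&0&1\end{bmatrix}$, $x,y,z\in\mathbb{F}_q$, with matrix multiplication, so $[x,y,z][x',y',z']=[x+x',y+y',z+z'+xy']$. $[A,A,0]=\{[x,y,0]:x,y\in A\}$ and $[A,A,0][A,A,0]=\{mm':m,m'\in[A,A,0]\}$. $X\ll Y$ (equivalently $Y\gg X$) means $X\le CY$ for an absolute constant $C>0$. -}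

module Defs where

open import Data.Nat using (ℕ)
open import Data.Product using (Σ; _×_; _,_)
open import Data.List using (List; length; filter; deduplicate; concatMap; map; _∷_; [])
open import Data.List.Membership.Propositional using (_∈_)
open import Data.List.Relation.Unary.Unique.Propositional using (Unique)
open import Relation.Nullary using (¬_; Dec)
open import Relation.Binary.PropositionalEquality using (_≡_)
open import Relation.Binary.Definitions using (DecidableEquality)
open import Algebra.Structures using (IsCommutativeRing)
open import Data.Product.Properties using (≡-dec)

record FiniteField : Set₁ where
  field
    Carrier : Set
    _+_ _*_ : Carrier → Carrier → Carrier
    -_ : Carrier → Carrier
    0# 1# : Carrier
    isCommutativeRing : IsCommutativeRing _≡_ _+_ _*_ -_ 0# 1#
    0≢1 : ¬ (0# ≡ 1#)
    inverse : ∀ x → ¬ (x ≡ 0#) → Σ Carrier (λ y → x * y ≡ 1#)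
    _≟_ : DecidableEquality Carrier
    elements : List Carrier
    elements-unique : Unique elements
    elements-complete : ∀ x → x ∈ elements

  order : ℕ
  order = length elements

  -- Heisenberg group elements [x,y,z]
  H : Set
  H = Carrier × Carrier × Carrier

  _·H_ : H → H → H
  (x , y , z) ·H (x' , y' , z') = (x + x') , (y + y') , ((z + z') + (x * y'))

  _≟H_ : DecidableEquality H
  _≟H_ = ≡-dec _≟_ (≡-dec _≟_ _≟_)

  AA0 : List Carrier → List H
  AA0 A = concatMap (λ x → map (λ y → (x , y , 0#)) A) A

  productSetSize : List Carrier → ℕ
  productSetSize A =
    length (deduplicate _≟H_
      (concatMap (λ m → map (λ m' → m ·H m') (AA0 A)) (AA0 A)))

  additiveEnergy : List Carrier → ℕ
  additiveEnergy A =
    length (filter (λ { (a , b , c , d) → (a + b) ≟ (c + d) })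
      (concatMap (λ a → concatMap (λ b → concatMap (λ c → map (λ d → (a , b , c , d)) A) A) A) A))

{-# OPTIONS --safe #-}
module Submission where

-- Slice the product set by its first coordinate s. The slice over s contains the points (b + d , a d)
-- with a, s − a, b, d ∈ A, so each line z = a (t − b) with a, s − a, b ∈ A and a ≠ 0 meets it in at
-- least |A| points. Two distinct such lines meet at most once, so a second-moment count over the
-- plane (Vinh's incidence bound) gives, for q = |F| and r(s) the number of such a,
--   |slice| ≥ q|A| / 2   or   |slice| ≥ r(s) |A|³ / (4q).
-- If the slices of the first kind carry less than half of Σ r(s) ≈ |A|², summing the second bound
-- gives |A|⁵ / q. Otherwise Cauchy–Schwarz against Σ r(s)² ≤ E⁺(A) shows that there are
-- ≫ |A|⁴ / E⁺(A) of them, each of size at least q|A| / 2.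

open import Defs
open import Data.Nat using (ℕ; zero; suc; _+_; _*_; _^_; _≤_; z≤n; s≤s; s≤s⁻¹; NonZero; >-nonZero)
open import Data.Nat.Properties hiding (_≟_)
open import Data.Nat.ListAction using (sum)
open import Data.Nat.ListAction.Properties using (sum-++)
open import Data.Nat.Tactic.RingSolver using (solve-∀)
open import Data.Product using (Σ; _×_; _,_; proj₁; proj₂; ∃)
open import Data.Product.Properties using (≡-dec)
open import Data.Sum using (_⊎_; inj₁; inj₂)
open import Data.List using (List; []; _∷_; _++_; length; map; deduplicate; filter; concatMap; cartesianProduct)
open import Data.List.Properties using (map-++; map-∘)
open import Data.List.Membership.Propositional using (_∈_)
open import Data.List.Membership.Propositional.Properties using (∈-map⁺; ∈-concatMap⁺; ∈-deduplicate⁺; ∈-filter⁻; ∈-cartesianProduct⁻; ∈-length)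
open import Data.List.Relation.Unary.Any as Any using (here; there)
open import Data.List.Relation.Unary.All as All using ()
open import Data.List.Relation.Unary.AllPairs using ([]; _∷_)
open import Data.List.Relation.Unary.Unique.Propositional using (Unique)
open import Data.List.Relation.Unary.Unique.Propositional.Properties using (filter⁺; cartesianProduct⁺)
open import Data.List.Relation.Unary.Unique.DecPropositional.Properties using (deduplicate-!)
open import Relation.Nullary using (Dec; yes; no; contradiction; ¬?; _×-dec_)
open import Relation.Unary using (Decidable)
open import Relation.Binary.Definitions using (DecidableEquality)
open import Relation.Binary.PropositionalEquality using (_≡_; _≢_; refl; sym; trans; cong; cong₂; subst)
open import Algebra.Bundles using (CommutativeRing)
open FiniteField using (Carrier; order; productSetSize; additiveEnergy)

-- Finite sums over lists.

private
  variable
    X Y : Set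
    P Q : Set

∑ : List X → (X → ℕ) → ℕ
∑ L f = sum (map f L)

infix 6 ∑
syntax ∑ L (λ x → e) = ∑[ x ∈ L ] e

∑-mono : ∀ (L : List X) {f g : X → ℕ} → (∀ {x} → x ∈ L → f x ≤ g x) → ∑ L f ≤ ∑ L g
∑-mono []      h = z≤n
∑-mono (x ∷ L) h = +-mono-≤ (h (here refl)) (∑-mono L λ x∈L → h (there x∈L))

∑-cong : ∀ (L : List X) {f g : X → ℕ} → (∀ x → f x ≡ g x) → ∑ L f ≡ ∑ L g
∑-cong []      h = refl
∑-cong (x ∷ L) h = cong₂ _+_ (h x) (∑-cong L h)

∑-distrib-+ : ∀ (L : List X) (f g : X → ℕ) → (∑[ x ∈ L ] (f x + g x)) ≡ ∑ L f + ∑ L g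
∑-distrib-+ []      f g = refl
∑-distrib-+ (x ∷ L) f g rewrite ∑-distrib-+ L f g = interchange (f x) (g x) (∑ L f) (∑ L g)
  where
  interchange : ∀ a b c d → (a + b) + (c + d) ≡ (a + c) + (b + d)
  interchange = solve-∀

∑-distrib-+₃ : ∀ (L : List X) (f g h : X → ℕ) →
  (∑[ x ∈ L ] (f x + g x + h x)) ≡ ∑ L f + ∑ L g + ∑ L h
∑-distrib-+₃ L f g h =
  trans (∑-distrib-+ L (λ x → f x + g x) h) (cong (_+ ∑ L h) (∑-distrib-+ L f g))

∑-distribˡ-* : ∀ (L : List X) k (f : X → ℕ) → (∑[ x ∈ L ] (k * f x)) ≡ k * ∑ L f
∑-distribˡ-* []      k f = sym (*-zeroʳ k)
∑-distribˡ-* (x ∷ L) k f rewrite ∑-distribˡ-* L k f = sym (*-distribˡ-+ k (f x) (∑ L f))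

∑-distribʳ-* : ∀ (L : List X) (f : X → ℕ) k → (∑[ x ∈ L ] (f x * k)) ≡ ∑ L f * k
∑-distribʳ-* L f k =
  trans (∑-cong L λ x → *-comm (f x) k) (trans (∑-distribˡ-* L k f) (*-comm k (∑ L f)))

∑-const : ∀ (L : List X) k → (∑[ x ∈ L ] k) ≡ length L * k
∑-const []      k = refl
∑-const (x ∷ L) k = cong (k +_) (∑-const L k)

∑-swap : ∀ (L : List X) (M : List Y) (f : X → Y → ℕ) →
  (∑[ x ∈ L ] ∑[ y ∈ M ] f x y) ≡ (∑[ y ∈ M ] ∑[ x ∈ L ] f x y)
∑-swap []      M f = sym (trans (∑-const M 0) (*-zeroʳ (length M)))
∑-swap (x ∷ L) M f rewrite ∑-swap L M f = sym (∑-distrib-+ M (f x) λ y → ∑[ z ∈ L ] f z y)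

∑-map : ∀ (L : List X) (f : X → Y) (g : Y → ℕ) → ∑ (map f L) g ≡ (∑[ x ∈ L ] g (f x))
∑-map L f g = cong sum (sym (map-∘ L))

∑-++ : ∀ (L M : List X) (f : X → ℕ) → ∑ (L ++ M) f ≡ ∑ L f + ∑ M f
∑-++ L M f = trans (cong sum (map-++ f L M)) (sum-++ (map f L) (map f M))

∑-concatMap : ∀ (L : List X) (f : X → List Y) (g : Y → ℕ) →
  ∑ (concatMap f L) g ≡ (∑[ x ∈ L ] ∑ (f x) g)
∑-concatMap []      f g = refl
∑-concatMap (x ∷ L) f g = trans (∑-++ (f x) (concatMap f L) g) (cong (∑ (f x) g +_) (∑-concatMap L f g))

∑-cartesianProduct : ∀ (L : List X) (M : List Y) (f : X × Y → ℕ) →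
  ∑ (cartesianProduct L M) f ≡ (∑[ x ∈ L ] ∑[ y ∈ M ] f (x , y))
∑-cartesianProduct []      M f = refl
∑-cartesianProduct (x ∷ L) M f =
  trans (∑-++ (map (x ,_) M) (cartesianProduct L M) f)
        (cong₂ _+_ (∑-map M (x ,_) f) (∑-cartesianProduct L M f))

term≤∑ : ∀ {L : List X} {x} (f : X → ℕ) → x ∈ L → f x ≤ ∑ L f
term≤∑ f (here refl)         = m≤m+n _ _
term≤∑ f (there {x = y} x∈L) = ≤-trans (term≤∑ f x∈L) (m≤n+m _ (f y))

∑-positive : ∀ (L : List X) {f : X → ℕ} → 1 ≤ ∑ L f → ∃ λ x → x ∈ L × 1 ≤ f x
∑-positive (x ∷ L) {f} h with f x in eq
... | suc _ = x , here refl , subst (1 ≤_) (sym eq) (s≤s z≤n)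
... | zero with ∑-positive L h
... | y , y∈L , 1≤fy = y , there y∈L , 1≤fy

∑*∑ : ∀ (L : List X) (M : List Y) (f : X → ℕ) (g : Y → ℕ) →
  (∑[ x ∈ L ] ∑[ y ∈ M ] (f x * g y)) ≡ ∑ L f * ∑ M g
∑*∑ L M f g = trans (∑-cong L λ x → ∑-distribˡ-* M (f x) g) (∑-distribʳ-* L f (∑ M g))

-- Double counting of weighted incidences, grouped by points on one side and by lines on the other.
∑-weighted-swap : ∀ (L : List X) (M : List Y) (g : X → ℕ) (w : Y → ℕ) (i : X → Y → ℕ) →
  (∑[ x ∈ L ] (g x * (∑[ y ∈ M ] (w y * i x y)))) ≡ (∑[ y ∈ M ] (w y * (∑[ x ∈ L ] (g x * i x y))))
∑-weighted-swap L M g w i =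
  trans (∑-cong L λ x → sym (∑-distribˡ-* M (g x) _))
  (trans (∑-swap L M _)
         (∑-cong M λ y → trans (∑-cong L λ x → exchange (g x) (w y) (i x y)) (∑-distribˡ-* L (w y) _)))
  where
  exchange : ∀ a b c → a * (b * c) ≡ b * (a * c)
  exchange = solve-∀

-- Weighted Cauchy-Schwarz inequality.

2mn≤m²+n² : ∀ m n → 2 * (m * n) ≤ m * m + n * n
2mn≤m²+n² m n with ≤-total m n
... | inj₁ m≤n with m≤n⇒∃[o]m+o≡n m≤n
...   | o , refl = subst (2 * (m * (m + o)) ≤_) (square m o) (m≤m+n _ (o * o))
  where
  square : ∀ m o → 2 * (m * (m + o)) + o * o ≡ m * m + (m + o) * (m + o)
  square = solve-∀
2mn≤m²+n² m n | inj₂ n≤m with m≤n⇒∃[o]m+o≡n n≤m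
...   | o , refl = subst (2 * ((n + o) * n) ≤_) (square n o) (m≤m+n _ (o * o))
  where
  square : ∀ n o → 2 * ((n + o) * n) + o * o ≡ (n + o) * (n + o) + n * n
  square = solve-∀

-- Expanding over pairs (x , y) and applying 2 f(x) f(y) ≤ f(x)² + f(y)² with weight w(x) w(y) gives
-- twice the claim. The weight will be an indicator: of a slice in the incidence bound, and of the
-- popular sums in the energy estimate.
∑-cauchy-schwarz : ∀ (L : List X) (w f : X → ℕ) →
  (∑[ x ∈ L ] (w x * f x)) * (∑[ x ∈ L ] (w x * f x)) ≤ ∑ L w * (∑[ x ∈ L ] (w x * (f x * f x)))
∑-cauchy-schwarz L w f = *-cancelˡ-≤ 2 (begin
  2 * (∑ L wf * ∑ L wf)
    ≡⟨ cong (2 *_) (∑*∑ L L wf wf) ⟨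
  2 * (∑[ x ∈ L ] ∑[ y ∈ L ] (wf x * wf y))
    ≡⟨ ∑-distribˡ-* L 2 _ ⟨
  (∑[ x ∈ L ] (2 * (∑[ y ∈ L ] (wf x * wf y))))
    ≡⟨ ∑-cong L (λ x → sym (∑-distribˡ-* L 2 _)) ⟩
  (∑[ x ∈ L ] ∑[ y ∈ L ] (2 * (wf x * wf y)))
    ≤⟨ ∑-mono L (λ {x} _ → ∑-mono L λ {y} _ → pointwise x y) ⟩
  (∑[ x ∈ L ] ∑[ y ∈ L ] (wff x * w y + w x * wff y))
    ≡⟨ ∑-cong L (λ x → ∑-distrib-+ L _ _) ⟩
  (∑[ x ∈ L ] ((∑[ y ∈ L ] (wff x * w y)) + (∑[ y ∈ L ] (w x * wff y))))
    ≡⟨ ∑-distrib-+ L _ _ ⟩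
  (∑[ x ∈ L ] ∑[ y ∈ L ] (wff x * w y)) + (∑[ x ∈ L ] ∑[ y ∈ L ] (w x * wff y))
    ≡⟨ cong₂ _+_ (∑*∑ L L wff w) (∑*∑ L L w wff) ⟩
  ∑ L wff * ∑ L w + ∑ L w * ∑ L wff
    ≡⟨ double (∑ L wff) (∑ L w) ⟩
  2 * (∑ L w * ∑ L wff) ∎)
  where
  open ≤-Reasoning
  wf wff : _ → ℕ
  wf x = w x * f x
  wff x = w x * (f x * f x)
  double : ∀ a b → a * b + b * a ≡ 2 * (b * a)
  double = solve-∀
  pointwise : ∀ x y → 2 * (wf x * wf y) ≤ wff x * w y + w x * wff y
  pointwise x y = begin
    2 * (w x * f x * (w y * f y))              ≡⟨ lhs (w x) (f x) (w y) (f y) ⟩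
    w x * w y * (2 * (f x * f y))              ≤⟨ *-monoʳ-≤ (w x * w y) (2mn≤m²+n² (f x) (f y)) ⟩
    w x * w y * (f x * f x + f y * f y)        ≡⟨ rhs (w x) (f x) (w y) (f y) ⟩
    w x * (f x * f x) * w y + w x * (w y * (f y * f y)) ∎
    where
    lhs : ∀ a b c d → 2 * (a * b * (c * d)) ≡ a * c * (2 * (b * d))
    lhs = solve-∀
    rhs : ∀ a b c d → a * c * (b * b + d * d) ≡ a * (b * b) * c + a * (c * (d * d))
    rhs = solve-∀

-- Indicators and counting.

ind : Dec P → ℕ
ind (yes _) = 1
ind (no _)  = 0

ind≤ : ∀ {k} (P? : Dec P) → (P → 1 ≤ k) → ind P? ≤ k
ind≤ (yes p) h = h p
ind≤ (no _)  h = z≤n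

1≤ind : (P? : Dec P) → P → 1 ≤ ind P?
1≤ind (yes _) p = s≤s z≤n
1≤ind (no ¬p) p = contradiction p ¬p

1≤ind⁻ : (P? : Dec P) → 1 ≤ ind P? → P
1≤ind⁻ (yes p) _ = p

length-filter≡∑ : ∀ {R : X → Set} (R? : Decidable R) (L : List X) →
  length (filter R? L) ≡ (∑[ x ∈ L ] ind (R? x))
length-filter≡∑ R? []      = refl
length-filter≡∑ R? (x ∷ L) with R? x
... | yes _ = cong suc (length-filter≡∑ R? L)
... | no _  = length-filter≡∑ R? L

-- At most one term of the sum is 1. The cap `k` has to be positive only when such a term occurs, so
-- it can be an indicator itself, as in `coincide`, and not just the constant 1.
∑-ind-subsingleton : ∀ {R : X → Set} (R? : Decidable R) {L : List X} {k} → Unique L →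
  (∀ x y → R x → R y → x ≡ y) → (∀ {x} → x ∈ L → R x → 1 ≤ k) →
  (∑[ x ∈ L ] ind (R? x)) ≤ k
∑-ind-subsingleton R? []                 sub h = z≤n
∑-ind-subsingleton R? {x ∷ L} (x∉L ∷ uniq) sub h with R? x
... | no _   = ∑-ind-subsingleton R? uniq sub λ y∈L → h (there y∈L)
... | yes rx = ≤-trans (s≤s (∑-ind-subsingleton R? uniq sub
                 λ y∈L ry → contradiction (sub _ _ rx ry) (All.lookup x∉L y∈L)))
                 (h (here refl) rx)

ind-× : (P? : Dec P) (Q? : Dec Q) → ind P? * ind Q? ≡ ind (P? ×-dec Q?)
ind-× (yes _) (yes _) = refl
ind-× (yes _) (no _)  = refl
ind-× (no _)  _       = refl

∑-filter-≤ : ∀ {R : X → Set} (R? : Decidable R) (L : List X) (f : X → ℕ) → ∑ (filter R? L) f ≤ ∑ L f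
∑-filter-≤ R? []      f = z≤n
∑-filter-≤ R? (x ∷ L) f with R? x
... | yes _ = +-monoʳ-≤ (f x) (∑-filter-≤ R? L f)
... | no _  = ≤-trans (∑-filter-≤ R? L f) (m≤n+m _ (f x))

length≡∑1 : ∀ (L : List X) → length L ≡ (∑[ x ∈ L ] 1)
length≡∑1 L = sym (trans (∑-const L 1) (*-identityʳ (length L)))

-- Arithmetic of the second-moment estimate.

u²≤4k : ∀ {u v k} → u * u + v * v ≤ k + 2 * (u * v) → 2 * v ≤ u → u * u ≤ 4 * k
u²≤4k {_} {v} {k} h 2v≤u with m≤n⇒∃[o]m+o≡n 2v≤u
-- With e = u - 2v the first hypothesis reads (u - v)² = (v + e)² ≤ k, and u ≤ 2 (v + e).
... | e , refl = begin
  (2 * v + e) * (2 * v + e)                              ≤⟨ m≤m+n _ (e * (4 * v + 3 * e)) ⟩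
  (2 * v + e) * (2 * v + e) + e * (4 * v + 3 * e)        ≡⟨ square v e ⟩
  4 * ((v + e) * (v + e))                                ≤⟨ *-monoʳ-≤ 4 [v+e]²≤k ⟩
  4 * k                                                  ∎
  where
  open ≤-Reasoning
  square : ∀ v e → (2 * v + e) * (2 * v + e) + e * (4 * v + 3 * e) ≡ 4 * ((v + e) * (v + e))
  square = solve-∀
  split : ∀ v e → (v + e) * (v + e) + 2 * ((2 * v + e) * v) ≡ (2 * v + e) * (2 * v + e) + v * v
  split = solve-∀
  [v+e]²≤k : (v + e) * (v + e) ≤ k
  [v+e]²≤k = +-cancelʳ-≤ (2 * ((2 * v + e) * v)) _ _ (subst (_≤ k + 2 * ((2 * v + e) * v)) (sym (split v e)) h)

-- Cauchy-Schwarz turns the first hypothesis, multiplied by p, into (q I - m p)² ≤ q³ m p. Since 2 m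
-- p ≤ q m n ≤ q I, `u²≤4k` yields (q I)² ≤ 4 q³ m p; inserting m n ≤ I leaves a common factor q² m
-- to cancel.
second-moment⇒mn²≤4qp : ∀ {q m n p I J} .{{_ : NonZero q}} →
  q * q * J + m * m * p ≤ q * q * q * m + 2 * (q * m * I) →
  I * I ≤ p * J → m * n ≤ I → 2 * p ≤ q * n → m * (n * n) ≤ 4 * q * p
second-moment⇒mn²≤4qp {q} {zero}  _ _ _ _ = z≤n
second-moment⇒mn²≤4qp {q} {m@(suc _)} {n} {p} {I} {J} h cs mn≤I 2p≤qn =
  *-cancelˡ-≤ (q * q * m) {{m*n≢0 (q * q) m {{m*n≢0 q q}}}} (begin
    q * q * m * (m * (n * n))         ≡⟨ e₁ q m n ⟩
    q * q * (m * n * (m * n))         ≤⟨ *-monoʳ-≤ (q * q) (*-mono-≤ mn≤I mn≤I) ⟩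
    q * q * (I * I)                   ≡⟨ e₂ q I ⟩
    q * I * (q * I)                   ≤⟨ u²≤4k {q * I} {m * p} {q * q * q * m * p} square half ⟩
    4 * (q * q * q * m * p)           ≡⟨ e₃ q m p ⟩
    q * q * m * (4 * q * p)           ∎)
  where
  open ≤-Reasoning
  e₁ : ∀ q m n → q * q * m * (m * (n * n)) ≡ q * q * (m * n * (m * n))
  e₁ = solve-∀
  e₂ : ∀ q I → q * q * (I * I) ≡ q * I * (q * I)
  e₂ = solve-∀
  e₃ : ∀ q m p → 4 * (q * q * q * m * p) ≡ q * q * m * (4 * q * p)
  e₃ = solve-∀
  e₄ : ∀ q m p J → q * q * (p * J) + m * p * (m * p) ≡ (q * q * J + m * m * p) * p
  e₄ = solve-∀
  e₅ : ∀ q m p I → (q * q * q * m + 2 * (q * m * I)) * p ≡ q * q * q * m * p + 2 * (q * I * (m * p))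
  e₅ = solve-∀
  e₆ : ∀ m p → 2 * (m * p) ≡ m * (2 * p)
  e₆ = solve-∀
  e₇ : ∀ q m n → m * (q * n) ≡ q * (m * n)
  e₇ = solve-∀
  square : q * I * (q * I) + m * p * (m * p) ≤ q * q * q * m * p + 2 * (q * I * (m * p))
  square = begin
    q * I * (q * I) + m * p * (m * p)          ≡⟨ cong (_+ m * p * (m * p)) (e₂ q I) ⟨
    q * q * (I * I) + m * p * (m * p)          ≤⟨ +-monoˡ-≤ (m * p * (m * p)) (*-monoʳ-≤ (q * q) cs) ⟩
    q * q * (p * J) + m * p * (m * p)          ≡⟨ e₄ q m p J ⟩
    (q * q * J + m * m * p) * p                ≤⟨ *-monoˡ-≤ p h ⟩
    (q * q * q * m + 2 * (q * m * I)) * p      ≡⟨ e₅ q m p I ⟩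
    q * q * q * m * p + 2 * (q * I * (m * p))  ∎
  half : 2 * (m * p) ≤ q * I
  half = begin
    2 * (m * p)  ≡⟨ e₆ m p ⟩
    m * (2 * p)  ≤⟨ *-monoʳ-≤ m 2p≤qn ⟩
    m * (q * n)  ≡⟨ e₇ q m n ⟩
    q * (m * n)  ≤⟨ *-monoʳ-≤ q mn≤I ⟩
    q * I        ∎

-- Vinh's incidence bound by second moments.

module Incidence {Pt Ln : Set} (_≟_ : DecidableEquality Ln)
  (points : List Pt) (lines : List Ln) (lines-unique : Unique lines)
  (i : Pt → Ln → ℕ) (χ : Pt → ℕ) (ω : Ln → ℕ) (χ≤1 : ∀ p → χ p ≤ 1) (ω≤1 : ∀ ℓ → ω ℓ ≤ 1)
  (q n : ℕ) .{{_ : NonZero q}} (∣points∣ : length points ≡ q * q)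
  (∣line∣ : ∀ ℓ → q ≤ ∑[ p ∈ points ] i p ℓ)
  (∣line∩line∣ : ∀ {ℓ ℓ′} → ℓ ∈ lines → ℓ′ ∈ lines →
    (∑[ p ∈ points ] (i p ℓ * i p ℓ′)) ≤ 1 + q * ind (ℓ ≟ ℓ′))
  (rich : ∀ {ℓ} → ℓ ∈ lines → 1 ≤ ω ℓ → n ≤ ∑[ p ∈ points ] (χ p * i p ℓ))
  where

  open ≤-Reasoning

  private
    m p : ℕ
    m = ∑ lines ω
    p = ∑ points χ

    -- With `ω` and `χ` as indicators of the chosen lines and points, this counts the chosen lines
    -- through a point.
    f : Pt → ℕ
    f x = ∑[ ℓ ∈ lines ] (ω ℓ * i x ℓ)

    -- `I` counts incidences between chosen points and chosen lines; `J` and `S` are the second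
    -- moments of `f` over the chosen points and over the whole plane.
    I J S : ℕ
    I = ∑[ x ∈ points ] (χ x * f x)
    J = ∑[ x ∈ points ] (χ x * (f x * f x))
    S = ∑[ x ∈ points ] (f x * f x)

    qm≤∑f : q * m ≤ ∑ points f
    qm≤∑f = begin
      q * m                                                   ≡⟨ ∑-distribˡ-* lines q ω ⟨
      (∑[ ℓ ∈ lines ] (q * ω ℓ))
        ≤⟨ ∑-mono lines (λ {ℓ} _ → ≤-trans (≤-reflexive (*-comm q (ω ℓ))) (*-monoʳ-≤ (ω ℓ) (∣line∣ ℓ))) ⟩
      (∑[ ℓ ∈ lines ] (ω ℓ * (∑[ x ∈ points ] i x ℓ)))        ≡⟨ ∑-cong lines (λ ℓ → ∑-distribˡ-* points (ω ℓ) _) ⟨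
      (∑[ ℓ ∈ lines ] ∑[ x ∈ points ] (ω ℓ * i x ℓ))          ≡⟨ ∑-swap lines points _ ⟩
      ∑ points f                                              ∎

    -- After swapping, each chosen line contributes its common points with ℓ: at most one, with at
    -- most q more when that line is ℓ itself.
    ∑i*f≤m+q : ∀ {ℓ} → ℓ ∈ lines → (∑[ x ∈ points ] (f x * i x ℓ)) ≤ m + q
    ∑i*f≤m+q {ℓ} ℓ∈lines = begin
      (∑[ x ∈ points ] (f x * i x ℓ))
        ≡⟨ ∑-cong points (λ x → *-comm (f x) (i x ℓ)) ⟩
      (∑[ x ∈ points ] (i x ℓ * f x))
        ≡⟨ ∑-weighted-swap points lines (λ x → i x ℓ) ω i ⟩
      (∑[ ℓ′ ∈ lines ] (ω ℓ′ * (∑[ x ∈ points ] (i x ℓ * i x ℓ′))))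
        ≤⟨ ∑-mono lines (λ {ℓ′} ℓ′∈ → bound (ω≤1 ℓ′) (∣line∩line∣ ℓ∈lines ℓ′∈)) ⟩
      (∑[ ℓ′ ∈ lines ] (ω ℓ′ + q * ind (ℓ ≟ ℓ′)))
        ≡⟨ trans (∑-distrib-+ lines ω _) (cong (m +_) (∑-distribˡ-* lines q _)) ⟩
      m + q * (∑[ ℓ′ ∈ lines ] ind (ℓ ≟ ℓ′))
        ≤⟨ +-monoʳ-≤ m (*-monoʳ-≤ q (∑-ind-subsingleton (ℓ ≟_) lines-unique
             (λ _ _ ℓ≡x ℓ≡y → trans (sym ℓ≡x) ℓ≡y) λ _ _ → ≤-refl)) ⟩
      m + q * 1
        ≡⟨ cong (m +_) (*-identityʳ q) ⟩
      m + q ∎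
      where
      bound : ∀ {w s t} → w ≤ 1 → s ≤ 1 + t → w * s ≤ w + t
      bound z≤n             s≤1+t = z≤n
      bound {s = s} (s≤s z≤n) s≤1+t = ≤-trans (≤-reflexive (*-identityˡ s)) s≤1+t

    S≤m²+mq : S ≤ m * (m + q)
    S≤m²+mq = begin
      S                                                            ≡⟨ ∑-weighted-swap points lines f ω i ⟩
      (∑[ ℓ ∈ lines ] (ω ℓ * (∑[ x ∈ points ] (f x * i x ℓ))))
        ≤⟨ ∑-mono lines (λ {ℓ} ℓ∈ → *-monoʳ-≤ (ω ℓ) (∑i*f≤m+q ℓ∈)) ⟩
      (∑[ ℓ ∈ lines ] (ω ℓ * (m + q)))                             ≡⟨ ∑-distribʳ-* lines ω (m + q) ⟩
      m * (m + q)                                                  ∎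

    mn≤I : m * n ≤ I
    mn≤I = begin
      m * n                                                        ≡⟨ ∑-distribʳ-* lines ω n ⟨
      (∑[ ℓ ∈ lines ] (ω ℓ * n))                                   ≤⟨ ∑-mono lines (λ ℓ∈ → bound (rich ℓ∈)) ⟩
      (∑[ ℓ ∈ lines ] (ω ℓ * (∑[ x ∈ points ] (χ x * i x ℓ))))     ≡⟨ ∑-weighted-swap points lines χ ω i ⟨
      I                                                            ∎
      where
      bound : ∀ {w s} → (1 ≤ w → n ≤ s) → w * n ≤ w * s
      bound {zero}  h = z≤n
      bound {suc w} h = *-monoʳ-≤ (suc w) (h (s≤s z≤n))

    -- This is ∑ χ (q f − m)² ≤ ∑ (q f − m)², rearranged so that no subtraction occurs.
    second-moment : q * q * J + m * m * p ≤ q * q * q * m + 2 * (q * m * I)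
    second-moment = +-cancelʳ-≤ (2 * (q * m) * (q * m)) _ _ (begin
      q * q * J + m * m * p + 2 * (q * m) * (q * m)
        -- The cross term -2 q m ∑ f of the sum over the whole plane has been moved to this side,
        -- where the lower bound q m ≤ ∑ f is the one that is needed.
        ≤⟨ +-monoʳ-≤ (q * q * J + m * m * p) (*-monoʳ-≤ (2 * (q * m)) qm≤∑f) ⟩
      q * q * J + m * m * p + 2 * (q * m) * ∑ points f
        ≡⟨ cong₂ _+_ (cong₂ _+_ (sym (∑-distribˡ-* points (q * q) _)) (sym (∑-distribˡ-* points (m * m) χ)))
                     (sym (∑-distribˡ-* points (2 * (q * m)) f)) ⟩
      (∑[ x ∈ points ] (q * q * (χ x * (f x * f x)))) + (∑[ x ∈ points ] (m * m * χ x))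
        + (∑[ x ∈ points ] (2 * (q * m) * f x))
        ≡⟨ ∑-distrib-+₃ points _ _ _ ⟨
      (∑[ x ∈ points ] (q * q * (χ x * (f x * f x)) + m * m * χ x + 2 * (q * m) * f x))
        ≤⟨ ∑-mono points (λ {x} _ → pointwise (f x) (χ≤1 x)) ⟩
      (∑[ x ∈ points ] (q * q * (f x * f x) + m * m + 2 * (q * m) * (χ x * f x)))
        ≡⟨ ∑-distrib-+₃ points _ _ _ ⟩
      (∑[ x ∈ points ] (q * q * (f x * f x))) + (∑[ x ∈ points ] (m * m))
        + (∑[ x ∈ points ] (2 * (q * m) * (χ x * f x)))
        ≡⟨ cong₂ _+_ (cong₂ _+_ (∑-distribˡ-* points (q * q) _)
                                (trans (∑-const points (m * m)) (cong (_* (m * m)) ∣points∣)))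
                     (∑-distribˡ-* points (2 * (q * m)) _) ⟩
      q * q * S + q * q * (m * m) + 2 * (q * m) * I
        ≤⟨ +-monoˡ-≤ (2 * (q * m) * I) (+-monoˡ-≤ (q * q * (m * m)) (*-monoʳ-≤ (q * q) S≤m²+mq)) ⟩
      q * q * (m * (m + q)) + q * q * (m * m) + 2 * (q * m) * I
        ≡⟨ collect q m I ⟩
      q * q * q * m + 2 * (q * m * I) + 2 * (q * m) * (q * m) ∎)
      where
      collect : ∀ q m I → q * q * (m * (m + q)) + q * q * (m * m) + 2 * (q * m) * I
                        ≡ q * q * q * m + 2 * (q * m * I) + 2 * (q * m) * (q * m)
      collect = solve-∀
      χ=0 : ∀ q m → q * q * 0 + m * m * 0 ≡ 0
      χ=0 = solve-∀
      χ=1 : ∀ q m y → q * q * (1 * (y * y)) + m * m * 1 + 2 * (q * m) * y ≡ q * q * (y * y) + m * m + 2 * (q * m) * (1 * y)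
      χ=1 = solve-∀
      lhs : ∀ q m y → 2 * (q * m) * y ≡ 2 * ((q * y) * m)
      lhs = solve-∀
      rhs : ∀ q m y → (q * y) * (q * y) + m * m ≡ q * q * (y * y) + m * m + 2 * (q * m) * 0
      rhs = solve-∀
      -- For c = 1 both sides agree; for c = 0 the claim is 0 ≤ (q y - m)².
      pointwise : ∀ {c} y → c ≤ 1 →
        q * q * (c * (y * y)) + m * m * c + 2 * (q * m) * y ≤ q * q * (y * y) + m * m + 2 * (q * m) * (c * y)
      pointwise y (s≤s z≤n) = ≤-reflexive (χ=1 q m y)
      pointwise y z≤n = begin
        q * q * 0 + m * m * 0 + 2 * (q * m) * y       ≡⟨ cong (_+ 2 * (q * m) * y) (χ=0 q m) ⟩
        2 * (q * m) * y                               ≡⟨ lhs q m y ⟩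
        2 * ((q * y) * m)                             ≤⟨ 2mn≤m²+n² (q * y) m ⟩
        (q * y) * (q * y) + m * m                     ≡⟨ rhs q m y ⟩
        q * q * (y * y) + m * m + 2 * (q * m) * 0     ∎

  -- The expected number of incidences is m p / q. Unless p ≥ q n / 2, this is at most half of the m
  -- n incidences that richness forces, and the second moment limits such an excess.
  incidence-bound : (q * n ≤ 2 * ∑ points χ) ⊎ (∑ lines ω * (n * n) ≤ 4 * q * ∑ points χ)
  incidence-bound with ≤-total (q * n) (2 * p)
  ... | inj₁ qn≤2p = inj₁ qn≤2p
  ... | inj₂ 2p≤qn = inj₂ (second-moment⇒mn²≤4qp second-moment (∑-cauchy-schwarz points χ f) mn≤I 2p≤qn)

-- Balancing popular against unpopular sums.

-- Splitting at X ≤ 2G says whether the popular sums carry at least half of the mass.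
popular-or-not : ∀ {n N X G P q E γ} →
  N * n ≤ X → n ≤ 2 * N → X * (n * n * n) ≤ 4 * q * P + n * n * n * G →
  γ * (q * n) ≤ 2 * P → G * G ≤ γ * E →
  (n ^ 5 ≤ 32 * P * q) ⊎ (q * n ^ 5 ≤ 32 * P * E)
popular-or-not {n} {N} {X} {G} {P} {q} {E} {γ} Nn≤X n≤2N split popular cs with ≤-total X (2 * G)
... | inj₂ 2G≤X = inj₁ (begin
  n ^ 5                        ≡⟨ e₁ n ⟩
  n * n * (n * n * n)          ≤⟨ *-monoˡ-≤ (n * n * n) n²≤2X ⟩
  2 * X * (n * n * n)          ≡⟨ *-assoc 2 X _ ⟩
  2 * (X * (n * n * n))        ≤⟨ *-monoʳ-≤ 2 Xn³≤8qP ⟩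
  -- The constant 16 would do here; the slack raises it to the 32 of the other case.
  2 * (8 * q * P)              ≤⟨ m≤m+n _ (16 * q * P) ⟩
  2 * (8 * q * P) + 16 * q * P ≡⟨ e₂ q P ⟩
  32 * P * q                   ∎)
  where
  open ≤-Reasoning
  e₁ : ∀ n → n * (n * (n * (n * (n * 1)))) ≡ n * n * (n * n * n)
  e₁ = solve-∀
  e₂ : ∀ q P → 2 * (8 * q * P) + 16 * q * P ≡ 32 * P * q
  e₂ = solve-∀
  e₃ : ∀ y → y + y ≡ 2 * y
  e₃ = solve-∀
  e₄ : ∀ q P k G → 2 * (4 * q * P + k * G) ≡ 8 * q * P + 2 * G * k
  e₄ = solve-∀
  n²≤2X : n * n ≤ 2 * X
  n²≤2X = begin
    n * n        ≤⟨ *-monoˡ-≤ n n≤2N ⟩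
    2 * N * n    ≡⟨ *-assoc 2 N n ⟩
    2 * (N * n)  ≤⟨ *-monoʳ-≤ 2 Nn≤X ⟩
    2 * X        ∎
  Xn³≤8qP : X * (n * n * n) ≤ 8 * q * P
  Xn³≤8qP = +-cancelʳ-≤ (X * (n * n * n)) _ _ (begin
    X * (n * n * n) + X * (n * n * n)         ≡⟨ e₃ (X * (n * n * n)) ⟩
    2 * (X * (n * n * n))                     ≤⟨ *-monoʳ-≤ 2 split ⟩
    2 * (4 * q * P + n * n * n * G)           ≡⟨ e₄ q P (n * n * n) G ⟩
    8 * q * P + 2 * G * (n * n * n)           ≤⟨ +-monoʳ-≤ (8 * q * P) (*-monoˡ-≤ (n * n * n) 2G≤X) ⟩
    8 * q * P + X * (n * n * n)               ∎)
... | inj₁ X≤2G = inj₂ (begin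
  q * n ^ 5                          ≡⟨ e₁ q n ⟩
  -- Squaring n² ≤ 4 G brings the factor 16, and `popular` brings the factor 2 that makes 32.
  q * n * (n * n * (n * n))          ≤⟨ *-monoʳ-≤ (q * n) (*-mono-≤ n²≤4G n²≤4G) ⟩
  q * n * (4 * G * (4 * G))          ≡⟨ e₂ (q * n) G ⟩
  16 * (q * n) * (G * G)             ≤⟨ *-monoʳ-≤ (16 * (q * n)) cs ⟩
  16 * (q * n) * (γ * E)             ≡⟨ e₃ (q * n) γ E ⟩
  16 * (γ * (q * n)) * E             ≤⟨ *-monoˡ-≤ E (*-monoʳ-≤ 16 popular) ⟩
  16 * (2 * P) * E                   ≡⟨ e₄ P E ⟩
  32 * P * E                         ∎)
  where
  open ≤-Reasoning
  e₁ : ∀ q n → q * (n * (n * (n * (n * (n * 1))))) ≡ q * n * (n * n * (n * n))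
  e₁ = solve-∀
  e₂ : ∀ k G → k * (4 * G * (4 * G)) ≡ 16 * k * (G * G)
  e₂ = solve-∀
  e₃ : ∀ k γ E → 16 * k * (γ * E) ≡ 16 * (γ * k) * E
  e₃ = solve-∀
  e₄ : ∀ P E → 16 * (2 * P) * E ≡ 32 * P * E
  e₄ = solve-∀
  e₅ : ∀ G → 2 * (2 * G) ≡ 4 * G
  e₅ = solve-∀
  n²≤4G : n * n ≤ 4 * G
  n²≤4G = begin
    n * n        ≤⟨ *-monoˡ-≤ n n≤2N ⟩
    2 * N * n    ≡⟨ *-assoc 2 N n ⟩
    2 * (N * n)  ≤⟨ *-monoʳ-≤ 2 Nn≤X ⟩
    2 * X        ≤⟨ *-monoʳ-≤ 2 X≤2G ⟩
    2 * (2 * G)  ≡⟨ e₅ G ⟩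
    4 * G        ∎

-- Field arithmetic and the intersection of two lines.

module FieldProperties (F : FiniteField) where
  open FiniteField F
    using (isCommutativeRing; inverse; _≟_; 0#)
    renaming (Carrier to K; _+_ to _⊕_; _*_ to _⊛_)

  private
    commutativeRing : CommutativeRing _ _
    commutativeRing = record { isCommutativeRing = isCommutativeRing }

  open CommutativeRing commutativeRing
    using (ring; +-abelianGroup; +-group)
    renaming (+-assoc to ⊕-assoc; +-identityˡ to ⊕-identityˡ; *-identityˡ to ⊛-identityˡ; *-assoc to ⊛-assoc; *-comm to ⊛-comm)
  open import Algebra.Properties.Group +-group
    using (x∙y⁻¹≈ε⇒x≈y; \\-leftDividesʳ; ∙-cancelˡ; ⁻¹-injective)
  open import Algebra.Properties.AbelianGroup +-abelianGroup using (xyx⁻¹≈y; ⁻¹-anti-homo‿-)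
  open import Algebra.Properties.Ring ring using (x[y-z]≈xy-xz)

  open CommutativeRing commutativeRing public using () renaming (_-_ to _⊖_)

  ⊕-cancelˡ : ∀ {x y z} → x ⊕ y ≡ x ⊕ z → y ≡ z
  ⊕-cancelˡ = ∙-cancelˡ _ _ _

  [x⊕y]⊖x≡y : ∀ x y → (x ⊕ y) ⊖ x ≡ y
  [x⊕y]⊖x≡y = xyx⁻¹≈y

  ⊛-cancelˡ : ∀ {a x y} → a ≢ 0# → a ⊛ x ≡ a ⊛ y → x ≡ y
  ⊛-cancelˡ {a} {x} {y} a≢0 ax≡ay with inverse a a≢0
  ... | a⁻¹ , aa⁻¹≡1 = trans (sym (undo x)) (trans (cong (a⁻¹ ⊛_) ax≡ay) (undo y))
    where
    undo : ∀ u → a⁻¹ ⊛ (a ⊛ u) ≡ u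
    undo u = trans (sym (⊛-assoc a⁻¹ a u))
               (trans (cong (_⊛ u) (trans (⊛-comm a⁻¹ a) aa⁻¹≡1)) (⊛-identityˡ u))

  ⊖-telescope : ∀ t u b → (t ⊖ b) ⊖ (u ⊖ b) ≡ t ⊖ u
  ⊖-telescope t u b =
    trans (cong ((t ⊖ b) ⊕_) (⁻¹-anti-homo‿- u b))
      (trans (⊕-assoc t _ _) (cong (t ⊕_) (\\-leftDividesʳ b _)))

  -- Subtracting the equations at t and u leaves a (t - u) = a′ (t - u). If t ≠ u, this forces a =
  -- a′, and cancelling a ≠ 0 in the equation at t then forces b = b′.
  lines-meet-once : ∀ {a b a′ b′ t u} → a ≢ 0# → (a , b) ≢ (a′ , b′) →
    a ⊛ (t ⊖ b) ≡ a′ ⊛ (t ⊖ b′) → a ⊛ (u ⊖ b) ≡ a′ ⊛ (u ⊖ b′) → t ≡ u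
  lines-meet-once {a} {b} {a′} {b′} {t} {u} a≢0 ℓ≢ℓ′ at-t at-u with t ≟ u
  ... | yes t≡u = t≡u
  ... | no t≢u  = contradiction (cong₂ _,_ a≡a′ b≡b′) ℓ≢ℓ′
    where
    expand : ∀ a b → a ⊛ (t ⊖ u) ≡ a ⊛ (t ⊖ b) ⊖ a ⊛ (u ⊖ b)
    expand a b = trans (cong (a ⊛_) (sym (⊖-telescope t u b))) (x[y-z]≈xy-xz a _ _)
    slopes : a ⊛ (t ⊖ u) ≡ a′ ⊛ (t ⊖ u)
    slopes = trans (expand a b) (trans (cong₂ _⊖_ at-t at-u) (sym (expand a′ b′)))
    a≡a′ : a ≡ a′
    a≡a′ = ⊛-cancelˡ (λ t⊖u≡0 → t≢u (x∙y⁻¹≈ε⇒x≈y t u t⊖u≡0))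
             (trans (⊛-comm _ a) (trans slopes (⊛-comm a′ _)))
    b≡b′ : b ≡ b′
    b≡b′ = ⁻¹-injective (⊕-cancelˡ (⊛-cancelˡ a≢0 (trans at-t (cong (_⊛ (t ⊖ b′)) (sym a≡a′)))))

  -- With z = a d, the left side is the third coordinate of [a,b,0][c,d,0] as the group law produces
  -- it.
  [0⊕0]⊕z≡z : ∀ z → (0# ⊕ 0#) ⊕ z ≡ z
  [0⊕0]⊕z≡z z = trans (cong (_⊕ z) (⊕-identityˡ 0#)) (⊕-identityˡ z)

-- Slices of the product set, with their points and lines.

module HeisenbergProducts (F : FiniteField) (A : List (Carrier F)) (A-unique : Unique A) where
  open FiniteField F
    using (_≟_; elements; elements-unique; elements-complete; 0#; H; _≟H_; _·H_; AA0)
    renaming (Carrier to K; _+_ to _⊕_; _*_ to _⊛_)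
  open FieldProperties F

  private
    q n : ℕ
    q = order F
    n = length A

    instance
      q≢0 : NonZero q
      q≢0 = >-nonZero (∈-length (elements-complete 0#))

    -- For a = 0 every b would give the same line z = 0. Leaving out 0 makes distinct pairs in
    -- `lines` distinct lines and costs at most one element of `A`.
    A* : List K
    A* = filter (λ a → ¬? (a ≟ 0#)) A

    products : List H
    products = concatMap (λ m → map (λ m′ → m ·H m′) (AA0 A)) (AA0 A)

    -- The list inside `productSetSize`, so that `length D` is that size by definition.
    D : List H
    D = deduplicate _≟H_ products

    D-unique : Unique D
    D-unique = deduplicate-! _≟H_ products

    ∈-AA0 : ∀ {a b} → a ∈ A → b ∈ A → (a , b , 0#) ∈ AA0 A
    ∈-AA0 a∈A b∈A = ∈-concatMap⁺ _ (Any.map (λ { refl → ∈-map⁺ _ b∈A }) a∈A)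

    ∈-D : ∀ {a b c d} → a ∈ A → b ∈ A → c ∈ A → d ∈ A → (a ⊕ c , b ⊕ d , a ⊛ d) ∈ D
    ∈-D {a} {b} {c} {d} a∈A b∈A c∈A d∈A = ∈-deduplicate⁺ _≟H_
      (subst (λ z → (a ⊕ c , b ⊕ d , z) ∈ products) ([0⊕0]⊕z≡z (a ⊛ d))
        (∈-concatMap⁺ _ (Any.map (λ { refl → ∈-map⁺ _ (∈-AA0 c∈A d∈A) }) (∈-AA0 a∈A b∈A))))

    points : List (K × K)
    points = cartesianProduct elements elements

    -- The pair (a , b) stands for the line z = a (t − b), and a point is (t , z).
    lines : List (K × K)
    lines = cartesianProduct A* A

    i : K × K → K × K → ℕ
    i (t , z) (a , b) = ind (z ≟ (a ⊛ (t ⊖ b)))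

    -- Indicator of the slice over s, written as a count in `D` so that summing over s and x
    -- recounts `D`.
    χ : K → K × K → ℕ
    χ s x = ∑[ h ∈ D ] ind (h ≟H (s , x))

    -- Indicator of s - a ∈ A, which selects the lines used for the slice over s.
    ω : K → K × K → ℕ
    ω s (a , b) = ∑[ c ∈ A ] ind ((a ⊕ c) ≟ s)

    p : K → ℕ
    p s = ∑ points (χ s)

    -- The number of nonzero a ∈ A with s - a ∈ A, read off from one line per slope.
    r : K → ℕ
    r s = ∑[ a ∈ A* ] ω s (a , a)

    ∈-lines⁻ : ∀ {a b} → (a , b) ∈ lines → a ∈ A × a ≢ 0# × b ∈ A
    ∈-lines⁻ ℓ∈ with ∈-cartesianProduct⁻ A* A ℓ∈
    ... | a∈A* , b∈A with ∈-filter⁻ (λ a → ¬? (a ≟ 0#)) a∈A*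
    ... | a∈A , a≢0 = a∈A , a≢0 , b∈A

    lines-unique : Unique lines
    lines-unique = cartesianProduct⁺ (filter⁺ _ A-unique) A-unique

    points-unique : Unique points
    points-unique = cartesianProduct⁺ elements-unique elements-unique

    open ≤-Reasoning

    -- The hypotheses of the incidence bound.

    χ≤1 : ∀ s x → χ s x ≤ 1
    χ≤1 s x = ∑-ind-subsingleton (_≟H (s , x)) D-unique (λ _ _ e e′ → trans e (sym e′)) λ _ _ → ≤-refl

    ω≤1 : ∀ s ℓ → ω s ℓ ≤ 1
    ω≤1 s (a , b) = ∑-ind-subsingleton (λ c → (a ⊕ c) ≟ s) A-unique
      (λ c c′ e e′ → ⊕-cancelˡ (trans e (sym e′))) λ _ _ → ≤-refl

    ∣points∣ : length points ≡ q * q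
    ∣points∣ = trans (length≡∑1 points) (trans (∑-cartesianProduct elements elements _)
      (trans (∑-cong elements λ _ → sym (length≡∑1 elements)) (∑-const elements q)))

    ∣line∣ : ∀ ℓ → q ≤ ∑[ x ∈ points ] i x ℓ
    ∣line∣ (a , b) = begin
      q                                                                 ≡⟨ length≡∑1 elements ⟩
      (∑[ t ∈ elements ] 1)
        ≤⟨ ∑-mono elements (λ {t} _ → ≤-trans (1≤ind (_ ≟ _) refl) (term≤∑ (λ z → i (t , z) (a , b)) (elements-complete _))) ⟩
      (∑[ t ∈ elements ] ∑[ z ∈ elements ] i (t , z) (a , b))            ≡⟨ ∑-cartesianProduct elements elements _ ⟨
      (∑[ x ∈ points ] i x (a , b))                                     ∎

    ∣line∣≤q : ∀ ℓ → (∑[ x ∈ points ] i x ℓ) ≤ q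
    ∣line∣≤q (a , b) = begin
      (∑[ x ∈ points ] i x (a , b))                                     ≡⟨ ∑-cartesianProduct elements elements _ ⟩
      (∑[ t ∈ elements ] ∑[ z ∈ elements ] i (t , z) (a , b))
        ≤⟨ ∑-mono elements (λ {t} _ → ∑-ind-subsingleton (_≟ (a ⊛ (t ⊖ b))) elements-unique
             (λ _ _ e e′ → trans e (sym e′)) λ _ _ → ≤-refl) ⟩
      (∑[ t ∈ elements ] 1)                                             ≡⟨ length≡∑1 elements ⟨
      q                                                                 ∎

    _≟ℓ_ : DecidableEquality (K × K)
    _≟ℓ_ = ≡-dec _≟_ _≟_

    ∣line∩line∣ : ∀ {ℓ ℓ′} → ℓ ∈ lines → ℓ′ ∈ lines →
      (∑[ x ∈ points ] (i x ℓ * i x ℓ′)) ≤ 1 + q * ind (ℓ ≟ℓ ℓ′)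
    ∣line∩line∣ {ℓ@(a , b)} {ℓ′@(a′ , b′)} ℓ∈ ℓ′∈ with ℓ ≟ℓ ℓ′
    ... | yes refl = begin
      (∑[ x ∈ points ] (i x ℓ * i x ℓ))
        ≤⟨ ∑-mono points (λ {x} _ → idem (i x ℓ) (ind≤1 (proj₂ x ≟ _))) ⟩
      (∑[ x ∈ points ] i x ℓ)             ≤⟨ ∣line∣≤q ℓ ⟩
      q                                   ≡⟨ *-identityʳ q ⟨
      q * 1                               ≤⟨ n≤1+n _ ⟩
      1 + q * 1                           ∎
      where
      ind≤1 : (P? : Dec P) → ind P? ≤ 1
      ind≤1 P? = ind≤ P? λ _ → ≤-refl
      idem : ∀ k → k ≤ 1 → k * k ≤ k
      idem _ z≤n       = z≤n
      idem _ (s≤s z≤n) = ≤-refl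
    ... | no ℓ≢ℓ′ = begin
      (∑[ x ∈ points ] (i x ℓ * i x ℓ′))
        ≡⟨ ∑-cong points (λ x → ind-× (proj₂ x ≟ _) (proj₂ x ≟ _)) ⟩
      (∑[ x ∈ points ] ind (on-both? x))
        ≤⟨ ∑-ind-subsingleton on-both? points-unique same (λ _ _ → ≤-refl) ⟩
      1
        ≤⟨ m≤m+n 1 _ ⟩
      1 + q * 0 ∎
      where
      on-both? = λ (x : K × K) → (proj₂ x ≟ (a ⊛ (proj₁ x ⊖ b))) ×-dec (proj₂ x ≟ (a′ ⊛ (proj₁ x ⊖ b′)))
      same : ∀ (x y : K × K) →
        (proj₂ x ≡ a ⊛ (proj₁ x ⊖ b) × proj₂ x ≡ a′ ⊛ (proj₁ x ⊖ b′)) →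
        (proj₂ y ≡ a ⊛ (proj₁ y ⊖ b) × proj₂ y ≡ a′ ⊛ (proj₁ y ⊖ b′)) → x ≡ y
      -- Each line is the graph of a function of t, so equal first coordinates identify the points.
      same (t , z) (u , w) (refl , e) (refl , e′)
        with refl ← lines-meet-once (proj₁ (proj₂ (∈-lines⁻ ℓ∈))) ℓ≢ℓ′ e e′ = refl

    -- For s = a + c, the line contains the points (b + d , a d), d ∈ A, of the slice.
    rich : ∀ s {ℓ} → ℓ ∈ lines → 1 ≤ ω s ℓ → n ≤ ∑[ x ∈ points ] (χ s x * i x ℓ)
    rich s {a , b} ℓ∈ 1≤ω with ∈-lines⁻ ℓ∈ | ∑-positive A 1≤ω
    ... | a∈A , _ , b∈A | c , c∈A , a+c-hits-s with 1≤ind⁻ ((a ⊕ c) ≟ s) a+c-hits-s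
    ... | refl = begin
      n
        ≡⟨ length≡∑1 A ⟩
      (∑[ d ∈ A ] 1)
        ≤⟨ ∑-mono A (λ {d} _ → ≤-trans (1≤ind ((b ⊕ d) ≟ _) refl) (term≤∑ (λ t → ind ((b ⊕ d) ≟ t)) (elements-complete _))) ⟩
      (∑[ d ∈ A ] ∑[ t ∈ elements ] ind ((b ⊕ d) ≟ t))
        ≡⟨ ∑-swap A elements _ ⟩
      (∑[ t ∈ elements ] ∑[ d ∈ A ] ind ((b ⊕ d) ≟ t))
        -- At most one d has b + d = t, and such a d puts (t , a (t - b)) into the slice, so χ
        -- itself can be the cap.
        ≤⟨ ∑-mono elements (λ {t} _ → ∑-ind-subsingleton (λ d → (b ⊕ d) ≟ t) A-unique
             (λ _ _ e e′ → ⊕-cancelˡ (trans e (sym e′))) hit) ⟩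
      (∑[ t ∈ elements ] χ s (t , a ⊛ (t ⊖ b)))
        ≤⟨ ∑-mono elements (λ {t} _ → ≤-trans (times-one (χ s _) (1≤ind (_ ≟ _) refl))
             (term≤∑ (λ z → χ s (t , z) * i (t , z) (a , b)) (elements-complete (a ⊛ (t ⊖ b))))) ⟩
      (∑[ t ∈ elements ] ∑[ z ∈ elements ] (χ s (t , z) * i (t , z) (a , b)))
        ≡⟨ ∑-cartesianProduct elements elements _ ⟨
      (∑[ x ∈ points ] (χ s x * i x (a , b))) ∎
      where
      times-one : ∀ k {l} → 1 ≤ l → k ≤ k * l
      times-one k {l} 1≤l = ≤-trans (≤-reflexive (sym (*-identityʳ k))) (*-monoʳ-≤ k 1≤l)
      hit : ∀ {t d} → d ∈ A → b ⊕ d ≡ t → 1 ≤ χ s (t , a ⊛ (t ⊖ b))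
      hit {d = d} d∈A refl = ≤-trans (1≤ind (_ ≟H _) (cong (λ y → (s , b ⊕ d , a ⊛ y)) (sym ([x⊕y]⊖x≡y b d))))
        (term≤∑ (λ h → ind (h ≟H (s , b ⊕ d , a ⊛ ((b ⊕ d) ⊖ b)))) (∈-D a∈A b∈A c∈A d∈A))

    -- Slice sizes and the size of the product set.

    ∑ω≡rn : ∀ s → ∑ lines (ω s) ≡ r s * n
    ∑ω≡rn s = trans (∑-cartesianProduct A* A _)
      (trans (∑-cong A* λ a → trans (∑-const A _) (*-comm n _)) (∑-distribʳ-* A* _ n))

    -- The condition s - a ∈ A is shared by all n lines of slope a, so m = r(s) n lines are chosen.
    -- Each is n-rich, and m n² = r(s) n³.
    slice-bound : ∀ s → (q * n ≤ 2 * p s) ⊎ (r s * (n * n * n) ≤ 4 * q * p s)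
    slice-bound s with Incidence.incidence-bound _≟ℓ_ points lines lines-unique i (χ s) (ω s) (χ≤1 s) (ω≤1 s)
                         q n ∣points∣ ∣line∣ ∣line∩line∣ (rich s)
    ... | inj₁ h = inj₁ h
    ... | inj₂ h = inj₂ (subst (_≤ 4 * q * p s) (trans (cong (_* (n * n)) (∑ω≡rn s)) (assoc (r s) n)) h)
      where
      assoc : ∀ r n → r * n * (n * n) ≡ r * (n * n * n)
      assoc = solve-∀

    -- An element of `D` determines its s and its point x, so it is counted in only one slice and at
    -- only one point.
    ∑p≤∣D∣ : ∑ elements p ≤ length D
    ∑p≤∣D∣ = begin
      (∑[ s ∈ elements ] ∑[ x ∈ points ] ∑[ h ∈ D ] ind (h ≟H (s , x)))
        ≡⟨ ∑-cartesianProduct elements points _ ⟨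
      (∑[ g ∈ cartesianProduct elements points ] ∑[ h ∈ D ] ind (h ≟H g))
        ≡⟨ ∑-swap (cartesianProduct elements points) D _ ⟩
      (∑[ h ∈ D ] ∑[ g ∈ cartesianProduct elements points ] ind (h ≟H g))
        ≤⟨ ∑-mono D (λ {h} _ → ∑-ind-subsingleton (h ≟H_) (cartesianProduct⁺ elements-unique points-unique)
             (λ _ _ e e′ → trans (sym e) e′) λ _ _ → ≤-refl) ⟩
      (∑[ h ∈ D ] 1)
        ≡⟨ length≡∑1 D ⟨
      length D ∎

    -- Representation counts and additive energy.

    ∣A*∣n≤∑r : length A* * n ≤ ∑ elements r
    ∣A*∣n≤∑r = begin
      length A* * n
        ≡⟨ ∑-const A* n ⟨
      (∑[ a ∈ A* ] n)
        ≡⟨ ∑-cong A* (λ _ → length≡∑1 A) ⟩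
      (∑[ a ∈ A* ] ∑[ c ∈ A ] 1)
        ≤⟨ ∑-mono A* (λ {a} _ → ∑-mono A λ {c} _ →
             ≤-trans (1≤ind ((a ⊕ c) ≟ _) refl) (term≤∑ (λ s → ind ((a ⊕ c) ≟ s)) (elements-complete _))) ⟩
      (∑[ a ∈ A* ] ∑[ c ∈ A ] ∑[ s ∈ elements ] ind ((a ⊕ c) ≟ s))
        ≡⟨ ∑-cong A* (λ a → ∑-swap A elements _) ⟩
      (∑[ a ∈ A* ] ∑[ s ∈ elements ] ω s (a , a))
        ≡⟨ ∑-swap A* elements _ ⟩
      ∑ elements r ∎

    pairs : List (K × K)
    pairs = cartesianProduct A A

    -- The full representation function of A + A, with a = 0 allowed again; the energy is its second
    -- moment.
    r₊ : K → ℕ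
    r₊ s = ∑[ π ∈ pairs ] ind ((proj₁ π ⊕ proj₂ π) ≟ s)

    r≤r₊ : ∀ s → r s ≤ r₊ s
    r≤r₊ s = ≤-trans (∑-filter-≤ _ A _) (≤-reflexive (sym (∑-cartesianProduct A A _)))

    energy≡∑ : additiveEnergy F A ≡
      (∑[ π ∈ pairs ] ∑[ ρ ∈ pairs ] ind ((proj₁ π ⊕ proj₂ π) ≟ (proj₁ ρ ⊕ proj₂ ρ)))
    energy≡∑ =
      trans (length-filter≡∑ _ (concatMap (λ a → concatMap (λ b → concatMap (λ c → map (λ d → (a , b , c , d)) A) A) A) A))
      (trans (∑-concatMap A _ _)
      (trans (∑-cong A λ a →
        trans (∑-concatMap A _ _) (∑-cong A λ b →
          trans (∑-concatMap A _ _) (trans (∑-cong A λ c → ∑-map A _ _) (sym (∑-cartesianProduct A A _)))))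
      (sym (∑-cartesianProduct A A _))))

    -- A pair of pairs enters r₊(s)² only if s equals both sums, hence for at most one s, and only
    -- when the two sums coincide.
    ∑r²≤energy : (∑[ s ∈ elements ] (r s * r s)) ≤ additiveEnergy F A
    ∑r²≤energy = begin
      (∑[ s ∈ elements ] (r s * r s))
        ≤⟨ ∑-mono elements (λ {s} _ → *-mono-≤ (r≤r₊ s) (r≤r₊ s)) ⟩
      (∑[ s ∈ elements ] (r₊ s * r₊ s))
        ≡⟨ ∑-cong elements (λ s → ∑*∑ pairs pairs _ _) ⟨
      (∑[ s ∈ elements ] ∑[ π ∈ pairs ] ∑[ ρ ∈ pairs ] (ind (σ π ≟ s) * ind (σ ρ ≟ s)))
        ≡⟨ ∑-swap elements pairs _ ⟩
      (∑[ π ∈ pairs ] ∑[ s ∈ elements ] ∑[ ρ ∈ pairs ] (ind (σ π ≟ s) * ind (σ ρ ≟ s)))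
        ≡⟨ ∑-cong pairs (λ π → ∑-swap elements pairs _) ⟩
      (∑[ π ∈ pairs ] ∑[ ρ ∈ pairs ] ∑[ s ∈ elements ] (ind (σ π ≟ s) * ind (σ ρ ≟ s)))
        ≤⟨ ∑-mono pairs (λ {π} _ → ∑-mono pairs λ {ρ} _ → coincide (σ π) (σ ρ)) ⟩
      (∑[ π ∈ pairs ] ∑[ ρ ∈ pairs ] ind (σ π ≟ σ ρ))
        ≡⟨ energy≡∑ ⟨
      additiveEnergy F A ∎
      where
      σ : K × K → K
      σ π = proj₁ π ⊕ proj₂ π
      coincide : ∀ x y → (∑[ s ∈ elements ] (ind (x ≟ s) * ind (y ≟ s))) ≤ ind (x ≟ y)
      coincide x y = ≤-trans (≤-reflexive (∑-cong elements λ s → ind-× (x ≟ s) (y ≟ s)))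
        (∑-ind-subsingleton (λ s → (x ≟ s) ×-dec (y ≟ s)) elements-unique
          (λ _ _ e e′ → trans (sym (proj₁ e)) (proj₁ e′))
          λ _ e → 1≤ind (x ≟ y) (trans (proj₁ e) (sym (proj₂ e))))

    -- `A` has no repetitions, so filtering out 0 removes at most one entry.
    n≤1+∣A*∣ : n ≤ 1 + length A*
    n≤1+∣A*∣ = begin
      n                                                                       ≡⟨ length≡∑1 A ⟩
      (∑[ a ∈ A ] 1)                                                          ≤⟨ ∑-mono A (λ {a} _ → split (a ≟ 0#)) ⟩
      (∑[ a ∈ A ] (ind (a ≟ 0#) + ind (¬? (a ≟ 0#))))                         ≡⟨ ∑-distrib-+ A _ _ ⟩
      (∑[ a ∈ A ] ind (a ≟ 0#)) + (∑[ a ∈ A ] ind (¬? (a ≟ 0#)))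
        ≤⟨ +-mono-≤ (∑-ind-subsingleton (_≟ 0#) A-unique (λ _ _ e e′ → trans e (sym e′)) λ _ _ → ≤-refl)
             (≤-reflexive (sym (length-filter≡∑ _ A))) ⟩
      1 + length A*                                                           ∎
      where
      split : (P? : Dec P) → 1 ≤ ind P? + ind (¬? P?)
      split (yes _) = ≤-refl
      split (no _)  = ≤-refl

    -- Popular sums: those whose slice has at least q n / 2 points.

    g : K → ℕ
    g s = ind ((q * n) ≤? (2 * p s))

    -- The share of ∑ r carried by the popular sums.
    G : ℕ
    G = ∑[ s ∈ elements ] (g s * r s)

    popular-count : ∑ elements g * (q * n) ≤ 2 * length D
    popular-count = begin
      ∑ elements g * (q * n)                   ≡⟨ ∑-distribʳ-* elements g (q * n) ⟨
      (∑[ s ∈ elements ] (g s * (q * n)))      ≤⟨ ∑-mono elements (λ {s} _ → bound ((q * n) ≤? (2 * p s))) ⟩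
      (∑[ s ∈ elements ] (2 * p s))            ≡⟨ ∑-distribˡ-* elements 2 p ⟩
      2 * ∑ elements p                         ≤⟨ *-monoʳ-≤ 2 ∑p≤∣D∣ ⟩
      2 * length D                             ∎
      where
      bound : ∀ {k l} (k≤l? : Dec (k ≤ l)) → ind k≤l? * k ≤ l
      bound (yes k≤l) = ≤-trans (≤-reflexive (*-identityˡ _)) k≤l
      bound (no _)    = z≤n

    -- A popular s has its term r(s) n³ covered by n³ G; any other s must satisfy the second
    -- alternative of `slice-bound`.
    unpopular-mass : ∑ elements r * (n * n * n) ≤ 4 * q * length D + n * n * n * G
    unpopular-mass = begin
      ∑ elements r * (n * n * n)                                         ≡⟨ ∑-distribʳ-* elements r _ ⟨
      (∑[ s ∈ elements ] (r s * (n * n * n)))                            ≤⟨ ∑-mono elements (λ {s} _ → bound s) ⟩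
      (∑[ s ∈ elements ] (4 * q * p s + n * n * n * (g s * r s)))        ≡⟨ ∑-distrib-+ elements _ _ ⟩
      (∑[ s ∈ elements ] (4 * q * p s)) + (∑[ s ∈ elements ] (n * n * n * (g s * r s)))
        ≡⟨ cong₂ _+_ (∑-distribˡ-* elements (4 * q) p) (∑-distribˡ-* elements (n * n * n) _) ⟩
      4 * q * ∑ elements p + n * n * n * G
        ≤⟨ +-monoˡ-≤ _ (*-monoʳ-≤ (4 * q) ∑p≤∣D∣) ⟩
      4 * q * length D + n * n * n * G                                   ∎
      where
      bound : ∀ s → r s * (n * n * n) ≤ 4 * q * p s + n * n * n * (g s * r s)
      bound s with (q * n) ≤? (2 * p s) | slice-bound s
      ... | yes _ | _      = ≤-trans (≤-reflexive (trans (*-comm (r s) _) (cong (n * n * n *_) (sym (*-identityˡ (r s)))))) (m≤n+m _ _)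
      ... | no ¬h | inj₁ h = contradiction h ¬h
      ... | no _  | inj₂ h = ≤-trans h (m≤m+n _ _)

    -- Cauchy-Schwarz with weight `g`; since g ≤ 1, the factor ∑ g r² is at most ∑ r².
    G²≤∑g*energy : G * G ≤ ∑ elements g * additiveEnergy F A
    G²≤∑g*energy = ≤-trans (∑-cauchy-schwarz elements g r) (*-monoʳ-≤ (∑ elements g)
      (≤-trans (∑-mono elements λ {s} _ → drop ((q * n) ≤? (2 * p s))) ∑r²≤energy))
      where
      drop : ∀ {k} (P? : Dec P) → ind P? * k ≤ k
      drop (yes _) = ≤-reflexive (*-identityˡ _)
      drop (no _)  = z≤n

  product-set-bound : 2 ≤ n →
    (n ^ 5 ≤ 32 * productSetSize F A * q) ⊎ (q * n ^ 5 ≤ 32 * productSetSize F A * additiveEnergy F A)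
  product-set-bound 2≤n =
    popular-or-not {n} {length A*} {∑ elements r} {G} {length D} {q} {additiveEnergy F A} {∑ elements g}
      ∣A*∣n≤∑r (n≤2N 2≤n n≤1+∣A*∣) unpopular-mass popular-count G²≤∑g*energy
    where
    -- From n ≥ 2 follows N ≥ n - 1 ≥ 1, so n ≤ 1 + N ≤ 2 N.
    n≤2N : ∀ {n N} → 2 ≤ n → n ≤ 1 + N → n ≤ 2 * N
    n≤2N {n} {N} 2≤n n≤1+N = ≤-trans n≤1+N (≤-trans (+-monoˡ-≤ N (s≤s⁻¹ (≤-trans 2≤n n≤1+N)))
      (≤-reflexive (cong (N +_) (sym (+-identityʳ N)))))

-- A lower bound by a minimum says that one of two bounds holds; each is stated with its denominator
-- cleared.
theorem2p2 : Σ ℕ (λ C → (F : FiniteField) → (A : List (Carrier F)) → Unique A →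
    ((length A ^ 5) ≤ C * productSetSize F A * order F)
    ⊎ (order F * (length A ^ 5) ≤ C * productSetSize F A * additiveEnergy F A))
theorem2p2 = 32 , bound
  where
  bound : (F : FiniteField) → (A : List (Carrier F)) → Unique A →
    ((length A ^ 5) ≤ 32 * productSetSize F A * order F)
    ⊎ (order F * (length A ^ 5) ≤ 32 * productSetSize F A * additiveEnergy F A)
  bound F []               _ = inj₁ z≤n
  -- A singleton is treated apart because its element may be 0, which leaves `A*` empty. The product
  -- set then has one element, and the claim computes to 1 ≤ 32 q.
  bound F (_ ∷ [])         _ = inj₁ (*-mono-≤ {1} {32} (s≤s z≤n) (∈-length (FiniteField.elements-complete F (FiniteField.0# F))))
  bound F A@(_ ∷ _ ∷ _) uniq = HeisenbergProducts.product-set-bound F A uniq (s≤s (s≤s z≤n))
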